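{- Let $G=(V,E)$ be a hypergraph and let $(V_1,\dots,V_k)$ be a maximal minimum $k$-partition in $G$ for an integer $k\ge 2$. Suppose $|V_1|\ge 2k-2$. Then for every subset $T\subseteq V\setminus V_1$ such that $T\cap V_j\neq\emptyset$ for every $j\in\{2,\dots,k\}$, there exists a subset $S\subseteq V_1$ with $|S|=2k-2$ such that $(V_1,V\setminus V_1)$ is the source maximal minimum $(S,T)$-terminal cut.
   Context: A hypergraph $G=(V,E)$ has a finite vertex set $V$ and a finite multiset $E$ of hyperedges (subsets of $V$); all hyperedges have unit cost. For $U\subseteq V$, $\overline{U}=V\setminus U$, and $d(U)$ is the number of hyperedges intersecting both $U$ and $\overline{U}$. For a partition $(P_1,\dots,P_h)$ of $V$ into non-empty sets (ordered tuple), $\mathrm{cost}(P_1,\dots,P_h)$ is the number of hyperedges intersecting at least two parts. A minimum $k$-partition is a $k$-partition of minimum cost. A minimum $k$-partition $(V_1,\dots,V_k)$ is a maximal minimum $k$-partition if there is no other minimum $k$-partition $(V_1',\dots,V_k')$ with $V_1\subsetneq V_1'$. For disjoint $S,T\subseteq V$, a 2-partition $(U,\overline{U})$ is an $(S,T)$-terminal cut if $S\subseteq U\subseteq V\setminus T$; it is a minimum $(S,T)$-terminal cut if $d(U)$ is minimum among all $(S,T)$-terminal cuts; the source maximal minimum $(S,T)$-terminal cut is the (unique) minimum $(S,T)$-terminal cut whose source set $U$ is inclusion-wise maximal. -}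

module Defs where

open import Data.Nat using (ℕ; suc; _≤_)
open import Data.Fin using (Fin; zero)
open import Data.Fin.Properties using (_≟_; any?)
open import Data.Fin.Subset using (Subset; _∈_; _⊆_; _⊂_; _∩_; ∁; Nonempty; Empty)
open import Data.Fin.Subset.Properties using (nonempty?)
open import Data.List using (List; length; filter)
open import Data.Product using (∃; _×_)
open import Data.Vec.Functional using (Vector)
open import Relation.Binary.PropositionalEquality using (_≡_; _≢_)
open import Relation.Nullary using (¬_; Dec)
open import Relation.Nullary.Decidable using (_×-dec_; ¬?)

-- The vertex set is Fin order; the multiset of hyperedges is a list, in which
-- repeated entries are parallel hyperedges.
record Hypergraph : Set where
  field
    order : ℕ
    edges : List (Subset order)

open Hypergraph public

VertexSet : Hypergraph → Set
VertexSet G = Subset (order G)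

Intersects : ∀ {n} → Subset n → Subset n → Set
Intersects e U = Nonempty (e ∩ U)

CrossesCut : ∀ {n} → Subset n → Subset n → Set
CrossesCut U e = Intersects e U × Intersects e (∁ U)

crossesCut? : ∀ {n} (U e : Subset n) → Dec (CrossesCut U e)
crossesCut? U e = nonempty? (e ∩ U) ×-dec nonempty? (e ∩ ∁ U)

d : (G : Hypergraph) → VertexSet G → ℕ
d G U = length (filter (crossesCut? U) (edges G))

CrossesParts : ∀ {n h} → Vector (Subset n) h → Subset n → Set
CrossesParts P e = ∃ λ i → ∃ λ j → i ≢ j × Intersects e (P i) × Intersects e (P j)

crossesParts? : ∀ {n h} (P : Vector (Subset n) h) (e : Subset n) → Dec (CrossesParts P e)
crossesParts? P e = any? λ i → any? λ j →
  ¬? (i ≟ j) ×-dec nonempty? (e ∩ P i) ×-dec nonempty? (e ∩ P j)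

cost : (G : Hypergraph) {h : ℕ} → Vector (VertexSet G) h → ℕ
cost G P = length (filter (crossesParts? P) (edges G))

record IsPartition {n h : ℕ} (P : Vector (Subset n) h) : Set where
  field
    nonempty : ∀ i → Nonempty (P i)
    disjoint : ∀ i j → i ≢ j → Empty (P i ∩ P j)
    covers   : ∀ v → ∃ λ i → v ∈ P i

record IsMinimumPartition (G : Hypergraph) {k : ℕ} (P : Vector (VertexSet G) k) : Set where
  field
    isPartition : IsPartition P
    minimum     : ∀ (Q : Vector (VertexSet G) k) → IsPartition Q → cost G P ≤ cost G Q

-- The first part V₁ of the ordered tuple is P zero.
record IsMaximalMinimumPartition (G : Hypergraph) {m : ℕ}
                                 (P : Vector (VertexSet G) (suc m)) : Set where
  field
    isMinimumPartition : IsMinimumPartition G P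
    maximal            : ¬ (∃ λ (Q : Vector (VertexSet G) (suc m)) →
                              IsMinimumPartition G Q × P zero ⊂ Q zero)

-- A cut (U , ∁ U) is represented by its source set U.
record IsTerminalCut {n : ℕ} (S T U : Subset n) : Set where
  field
    source-nonempty : Nonempty U
    sink-nonempty   : Nonempty (∁ U)
    S⊆U             : S ⊆ U
    U⊆∁T            : U ⊆ ∁ T

record IsMinimumTerminalCut (G : Hypergraph) (S T U : VertexSet G) : Set where
  field
    isTerminalCut : IsTerminalCut S T U
    minimum       : ∀ U′ → IsTerminalCut S T U′ → d G U ≤ d G U′

record IsInclusionMaximalMinimumTerminalCut (G : Hypergraph) (S T U : VertexSet G) : Set where
  field
    isMinimumTerminalCut : IsMinimumTerminalCut G S T U
    maximal              : ¬ (∃ λ U′ → IsMinimumTerminalCut G S T U′ × U ⊂ U′)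

-- The definite article: U is an inclusion-wise maximal minimum (S , T)-terminal
-- cut, and it is the only one.
record IsSourceMaximalMinimumTerminalCut (G : Hypergraph) (S T U : VertexSet G) : Set where
  field
    isInclusionMaximal : IsInclusionMaximalMinimumTerminalCut G S T U
    unique             : ∀ U′ → IsInclusionMaximalMinimumTerminalCut G S T U′ → U′ ≡ U

{-# OPTIONS --safe #-}
module Submission where

-- Write V₁ for the first part and k for the number of parts. Minimality and
-- maximality of the partition, with submodularity of d, reduce the claim to
-- finding S ⊆ V₁ of size 2k−2 that is good: d V₁ ≤ d U whenever S ⊆ U ⊆ V₁.
-- Start from S = V₁ and delete vertices as long as S stays good. Suppose this
-- gets stuck with |S| > 2k−2: then every u in S has a cut Uᵤ with
-- S − u ⊆ Uᵤ ⊆ V₁, u ∉ Uᵤ and d Uᵤ < d V₁. Pick 2k−2 such u and label every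
-- vertex by the complements of the Uᵤ containing it: none, exactly one (which),
-- or at least two. In the metric where "none" and "at least two" are at distance
-- two, as are two different "exactly one" labels, and all other distinct labels
-- are at distance one, let Φ be the sum over hyperedges of the diameter of their
-- labels. Adding the cut U to the family changes Φ by at most d U − d K, where
-- ∁ K is the set of vertices outside U already labelled "at least two"; from the
-- third cut on K is an (S, ∁ V₁)-cut, so d K ≥ d V₁ > d U and Φ does not grow.
-- Hence Φ < 2 d V₁. Finally split the 2k−2 "exactly one" classes into two halves;
-- each half, with everything else merged into one part, is a k-partition, and the
-- two costs add up to at most Φ < 2 d V₁ ≤ 2 cost V, contradicting minimality.

open import Defs
open import Data.Bool using (Bool; true; false)
open import Data.Bool.Properties using () renaming (_≟_ to _≟ᵇ_)
open import Data.Empty using (⊥; ⊥-elim)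
open import Data.Fin using (Fin; zero; suc; _↑ˡ_; _↑ʳ_; inject≤; splitAt)
open import Data.Fin.Properties using (_≟_; any?; all?; ↑ˡ-injective; ↑ʳ-injective; splitAt-↑ˡ; splitAt-↑ʳ; suc-injective; inject≤-injective)
open import Data.Fin.Subset using (Subset; inside; outside; _∈_; _∉_; _⊆_; _∩_; _∪_; _─_; _-_; ∁; Nonempty; ∣_∣)
open import Data.Fin.Subset.Properties using (_∈?_; _⊆?_; anySubset?; nonempty?; ⊆-antisym; x∈∁p⇒x∉p; x∉p⇒x∈∁p; x∈p∩q⁺; x∈p∩q⁻; x∈p∪q⁺; x∈p∪q⁻; x∈p∧x≢y⇒x∈p-y; x∈p∧x∉q⇒x∈p─q; x∈p⇒∣p-x∣<∣p∣; p─q⊆p; p─⊥≡p; p⊆p∪q; p∩q⊆q; q⊆p∪q)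
open import Data.List using (List; []; _∷_; length; filter; map; allFin)
open import Data.List.Membership.Propositional using () renaming (_∈_ to _∈ˡ_)
open import Data.List.Membership.Propositional.Properties using (∈-allFin)
open import Data.List.Properties using (length-tabulate)
open import Data.List.Relation.Unary.All using (All; []; _∷_)
open import Data.List.Relation.Unary.All.Properties using (All¬⇒¬Any)
open import Data.List.Relation.Unary.AllPairs using ([]; _∷_)
open import Data.List.Relation.Unary.Any using (here; there)
open import Data.List.Relation.Unary.Unique.Propositional using (Unique)
open import Data.List.Relation.Unary.Unique.Propositional.Properties using (allFin⁺)
open import Data.Nat using (ℕ; suc; _+_; _≤_; _<_; _*_; _∸_; z≤n; s≤s; s≤s⁻¹)
open import Data.Nat.ListAction using (sum)
open import Data.Nat.Properties using (≤-refl; ≤-trans; ≤-antisym; <⇒≱; ≤-reflexive; <-irrefl; <⇒≤; ≤-<-trans; ≮⇒≥; _<?_; m≤m+n; m≤n+m; n≤1+n; +-assoc; +-mono-≤; +-mono-<; +-monoˡ-≤; +-monoʳ-≤; +-cancelˡ-≤; +-cancelʳ-≤; +-suc; +-identityʳ; m∸n+n≡m; +-commutativeSemigroup; module ≤-Reasoning)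
open import Algebra.Properties.CommutativeSemigroup +-commutativeSemigroup using (interchange)
open import Data.Product using (∃; ∃₂; _×_; _,_; proj₁; proj₂) renaming (map to ×-map)
open import Data.Product.Properties using (≡-dec)
open import Data.Sum using (_⊎_; inj₁; inj₂) renaming (map to ⊎-map)
open import Data.Vec using (lookup; tabulate; []; _∷_; here; there)
open import Data.Vec.Functional using (Vector)
open import Data.Vec.Properties using ([]=⇒lookup; lookup⇒[]=; lookup∘tabulate)
open import Function using (_∘_; id)
open import Function.Definitions using (Injective)
open import Relation.Binary.PropositionalEquality using (_≡_; _≢_; refl; sym; trans; cong; cong₂; subst; subst₂)
open import Relation.Nullary using (¬_; Dec; yes; no; does; contradiction)
open import Relation.Nullary.Decidable using (_×-dec_; ¬?; dec-true)
open import Relation.Nullary.Decidable.Core using (decidable-stable)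
open import Relation.Unary using (Decidable)

private variable
  n m p h : ℕ
  A B C D : Set

-- Counting hyperedges

total : (A → ℕ) → List A → ℕ
total f xs = sum (map f xs)

total-+-mono : {f g f′ g′ : A → ℕ} → (∀ x → f x + g x ≤ f′ x + g′ x) →
               ∀ xs → total f xs + total g xs ≤ total f′ xs + total g′ xs
total-+-mono le [] = z≤n
total-+-mono {f = f} {g} {f′} {g′} le (x ∷ xs) = begin
  (f x + total f xs) + (g x + total g xs)     ≡⟨ interchange (f x) _ (g x) _ ⟩
  (f x + g x) + (total f xs + total g xs)     ≤⟨ +-mono-≤ (le x) (total-+-mono le xs) ⟩
  (f′ x + g′ x) + (total f′ xs + total g′ xs) ≡⟨ interchange (f′ x) (g′ x) _ _ ⟩
  (f′ x + total f′ xs) + (g′ x + total g′ xs) ∎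
  where open ≤-Reasoning

indicator : Dec A → ℕ
indicator (yes _) = 1
indicator (no  _) = 0

length-filter≡total : {P : A → Set} (P? : Decidable P) (xs : List A) →
                      length (filter P? xs) ≡ total (indicator ∘ P?) xs
length-filter≡total P? [] = refl
length-filter≡total P? (x ∷ xs) with P? x
... | yes _ = cong suc (length-filter≡total P? xs)
... | no  _ = length-filter≡total P? xs

total-zero : {f : A → ℕ} → (∀ x → f x ≡ 0) → ∀ xs → total f xs ≡ 0
total-zero f≡0 []       = refl
total-zero f≡0 (x ∷ xs) = cong₂ _+_ (f≡0 x) (total-zero f≡0 xs)

indicator-no : (a? : Dec A) → ¬ A → indicator a? ≡ 0
indicator-no (yes a) ¬a = contradiction a ¬a
indicator-no (no  _) _  = refl

indicator-yes : (a? : Dec A) → A → 1 ≤ indicator a?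
indicator-yes (yes _) _ = ≤-refl
indicator-yes (no ¬a) a = contradiction a ¬a

indicator-either : (a? : Dec A) (b? : Dec B) → A ⊎ B → 1 ≤ indicator a? + indicator b?
indicator-either a? b? (inj₁ a) = ≤-trans (indicator-yes a? a) (m≤m+n _ _)
indicator-either a? b? (inj₂ b) = ≤-trans (indicator-yes b? b) (m≤n+m _ _)

indicator-+-mono : (c? : Dec C) (d? : Dec D) (a? : Dec A) (b? : Dec B) →
                   (C → A ⊎ B) → (D → A ⊎ B) → (C → D → A × B) →
                   indicator c? + indicator d? ≤ indicator a? + indicator b?
indicator-+-mono (no  _) (no  _) a? b? f g h = z≤n
indicator-+-mono (no  _) (yes d) a? b? f g h = indicator-either a? b? (g d)
indicator-+-mono (yes c) (no  _) a? b? f g h = indicator-either a? b? (f c)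
indicator-+-mono (yes c) (yes d) a? b? f g h =
  +-mono-≤ (indicator-yes a? (proj₁ (h c d))) (indicator-yes b? (proj₂ (h c d)))

-- Uncrossing inequalities are checked hyperedge by hyperedge: an element counted once on the left
-- is charged to either filter on the right, one counted twice to both.
length-filter-+-mono :
  {P Q R S : A → Set} (P? : Decidable P) (Q? : Decidable Q) (R? : Decidable R) (S? : Decidable S) →
  (∀ x → P x → R x ⊎ S x) → (∀ x → Q x → R x ⊎ S x) → (∀ x → P x → Q x → R x × S x) →
  ∀ xs → length (filter P? xs) + length (filter Q? xs) ≤ length (filter R? xs) + length (filter S? xs)
length-filter-+-mono P? Q? R? S? f g h xs
  rewrite length-filter≡total P? xs | length-filter≡total Q? xs
        | length-filter≡total R? xs | length-filter≡total S? xs =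
  total-+-mono (λ x → indicator-+-mono (P? x) (Q? x) (R? x) (S? x) (f x) (g x) (h x)) xs

-- Subsets of Fin n

comprehension : {P : Fin n → Set} → Decidable P → Subset n
comprehension P? = tabulate (does ∘ P?)

∈-comprehension⁺ : {P : Fin n → Set} (P? : Decidable P) {x : Fin n} → P x → x ∈ comprehension P?
∈-comprehension⁺ P? {x} px =
  lookup⇒[]= x _ (trans (lookup∘tabulate (does ∘ P?) x) (dec-true (P? x) px))

∈-comprehension⁻ : {P : Fin n → Set} (P? : Decidable P) {x : Fin n} → x ∈ comprehension P? → P x
∈-comprehension⁻ P? {x} x∈ with P? x | trans (sym (lookup∘tabulate (does ∘ P?) x)) ([]=⇒lookup x∈)
... | yes px | _  = px
... | no  _  | ()

∉⇒lookup : {U : Subset n} {x : Fin n} → x ∉ U → lookup U x ≡ false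
∉⇒lookup {U = U} {x} x∉U with lookup U x in eq
... | true  = contradiction (lookup⇒[]= x U eq) x∉U
... | false = refl

lookup⇒∉ : {U : Subset n} {x : Fin n} → lookup U x ≡ false → x ∉ U
lookup⇒∉ eq x∈U with trans (sym eq) ([]=⇒lookup x∈U)
... | ()

x∈p─q⇒x∉q : (P Q : Subset n) {x : Fin n} → x ∈ P ─ Q → x ∉ Q
x∈p─q⇒x∉q (inside ∷ P)  (outside ∷ Q) here        ()
x∈p─q⇒x∉q (_      ∷ P)  (_       ∷ Q) (there x∈) (there x∈Q) = x∈p─q⇒x∉q P Q x∈ x∈Q

element : (S : Subset n) → Fin ∣ S ∣ → Fin n
element (inside  ∷ S) zero    = zero
element (inside  ∷ S) (suc i) = suc (element S i)
element (outside ∷ S) i       = suc (element S i)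

element-∈ : (S : Subset n) (i : Fin ∣ S ∣) → element S i ∈ S
element-∈ (inside  ∷ S) zero    = here
element-∈ (inside  ∷ S) (suc i) = there (element-∈ S i)
element-∈ (outside ∷ S) i       = there (element-∈ S i)

element-injective : (S : Subset n) → Injective _≡_ _≡_ (element S)
element-injective (inside  ∷ S) {zero}  {zero}  eq = refl
element-injective (inside  ∷ S) {suc i} {suc j} eq = cong suc (element-injective S (suc-injective eq))
element-injective (outside ∷ S) eq = element-injective S (suc-injective eq)

∣p∣≤1+∣p-x∣ : (S : Subset n) (x : Fin n) → ∣ S ∣ ≤ suc ∣ S - x ∣
∣p∣≤1+∣p-x∣ (inside  ∷ S) zero    = s≤s (≤-reflexive (cong ∣_∣ (sym (p─⊥≡p S))))
∣p∣≤1+∣p-x∣ (outside ∷ S) zero    = ≤-trans (≤-reflexive (cong ∣_∣ (sym (p─⊥≡p S)))) (n≤1+n _)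
∣p∣≤1+∣p-x∣ (inside  ∷ S) (suc x) = s≤s (∣p∣≤1+∣p-x∣ S x)
∣p∣≤1+∣p-x∣ (outside ∷ S) (suc x) = ∣p∣≤1+∣p-x∣ S x

-- Cuts and submodularity

intersects : {e U : Subset n} {x : Fin n} → x ∈ e → x ∈ U → Intersects e U
intersects x∈e x∈U = _ , x∈p∩q⁺ (x∈e , x∈U)

intersects⁻ : (e U : Subset n) → Intersects e U → ∃ λ x → x ∈ e × x ∈ U
intersects⁻ e U (x , x∈) = x , x∈p∩q⁻ e U x∈

crossesCut : {U e : Subset n} {x y : Fin n} → x ∈ e → x ∈ U → y ∈ e → y ∉ U → CrossesCut U e
crossesCut x∈e x∈U y∈e y∉U = intersects x∈e x∈U , intersects y∈e (x∉p⇒x∈∁p y∉U)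

crossesCut⁻ : {U e : Subset n} → CrossesCut U e →
              ∃₂ λ x y → (x ∈ e × x ∈ U) × (y ∈ e × y ∉ U)
crossesCut⁻ {U = U} {e} (c , c′) with intersects⁻ e U c | intersects⁻ e (∁ U) c′
... | x , x∈ | y , y∈e , y∈∁U = x , y , x∈ , (y∈e , x∈∁p⇒x∉p y∈∁U)

d-submodular : (G : Hypergraph) (U W : VertexSet G) → d G (U ∪ W) + d G (U ∩ W) ≤ d G U + d G W
d-submodular G U W = length-filter-+-mono
  (crossesCut? (U ∪ W)) (crossesCut? (U ∩ W)) (crossesCut? U) (crossesCut? W) ∪-crossing ∩-crossing both (edges G)
  where
  ∪-crossing : ∀ e → CrossesCut (U ∪ W) e → CrossesCut U e ⊎ CrossesCut W e
  ∪-crossing e c with crossesCut⁻ c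
  ... | x , y , (x∈e , x∈∪) , (y∈e , y∉∪) with x∈p∪q⁻ U W x∈∪
  ...   | inj₁ x∈U = inj₁ (crossesCut x∈e x∈U y∈e (y∉∪ ∘ x∈p∪q⁺ ∘ inj₁))
  ...   | inj₂ x∈W = inj₂ (crossesCut x∈e x∈W y∈e (y∉∪ ∘ x∈p∪q⁺ ∘ inj₂))
  ∩-crossing : ∀ e → CrossesCut (U ∩ W) e → CrossesCut U e ⊎ CrossesCut W e
  ∩-crossing e c with crossesCut⁻ c
  ... | x , y , (x∈e , x∈∩) , (y∈e , y∉∩) with x∈p∩q⁻ U W x∈∩ | y ∈? U
  ...   | x∈U , x∈W | no  y∉U = inj₁ (crossesCut x∈e x∈U y∈e y∉U)
  ...   | x∈U , x∈W | yes y∈U = inj₂ (crossesCut x∈e x∈W y∈e (λ y∈W → y∉∩ (x∈p∩q⁺ (y∈U , y∈W))))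
  -- A vertex in both sets and a vertex in neither witness both crossings.
  both : ∀ e → CrossesCut (U ∪ W) e → CrossesCut (U ∩ W) e → CrossesCut U e × CrossesCut W e
  both e c c′ with crossesCut⁻ c | crossesCut⁻ c′
  ... | _ , y , _ , (y∈e , y∉∪) | x , _ , (x∈e , x∈∩) , _ with x∈p∩q⁻ U W x∈∩
  ...   | x∈U , x∈W = crossesCut x∈e x∈U y∈e (y∉∪ ∘ x∈p∪q⁺ ∘ inj₁)
                    , crossesCut x∈e x∈W y∈e (y∉∪ ∘ x∈p∪q⁺ ∘ inj₂)

-- Labels

-- For a family of sets indexed by Fin p: a point lies in none of them, in the
-- i-th one only, or in at least two.
data Label (p : ℕ) : Set where
  none  : Label p
  once  : Fin p → Label p
  twice : Label p

once-injective : {i j : Fin p} → once i ≡ once j → i ≡ j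
once-injective refl = refl

_≟ˡ_ : (k l : Label p) → Dec (k ≡ l)
none   ≟ˡ none   = yes refl
none   ≟ˡ once _ = no λ ()
none   ≟ˡ twice  = no λ ()
once _ ≟ˡ none   = no λ ()
once i ≟ˡ once j with i ≟ j
... | yes refl = yes refl
... | no  i≢j  = no (i≢j ∘ once-injective)
once _ ≟ˡ twice  = no λ ()
twice  ≟ˡ none   = no λ ()
twice  ≟ˡ once _ = no λ ()
twice  ≟ˡ twice  = yes refl

-- Distance two in the complete bipartite graph with sides {none, twice} and
-- {once i | i}; distinct labels that are not far apart have distance one.
data Far {p : ℕ} : Label p → Label p → Set where
  none-twice : Far none twice
  twice-none : Far twice none
  once-once  : {i j : Fin p} → i ≢ j → Far (once i) (once j)

far-sym : {k l : Label p} → Far k l → Far l k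
far-sym none-twice      = twice-none
far-sym twice-none      = none-twice
far-sym (once-once i≢j) = once-once (i≢j ∘ sym)

far⇒≢ : {k l : Label p} → Far k l → k ≢ l
far⇒≢ (once-once i≢j) refl = i≢j refl

far? : (k l : Label p) → Dec (Far k l)
far? none     none     = no λ ()
far? none     (once _) = no λ ()
far? none     twice    = yes none-twice
far? (once _) none     = no λ ()
far? (once i) (once j) with i ≟ j
... | yes refl = no λ f → far⇒≢ f refl
... | no  i≢j  = yes (once-once i≢j)
far? (once _) twice    = no λ ()
far? twice    none     = yes twice-none
far? twice    (once _) = no λ ()
far? twice    twice    = no λ ()

mark : Fin p → Label p → Label p
mark i none     = once i
mark i (once _) = twice
mark i twice    = twice

-- The new member i of the family is the complement of a cut; the Boolean tells
-- whether the point lies in the cut.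
relabel : Fin p → Label p × Bool → Label p
relabel i (l , true)  = l
relabel i (l , false) = mark i l

module _ {p : ℕ} (i : Fin p) where

  -- Marking moves a label by distance at most one, so equal old labels cannot end up far apart.
  far-mark⇒≢ : (k l : Label p) → Far k (mark i l) → k ≢ l
  far-mark⇒≢ _ none     (once-once _) ()
  far-mark⇒≢ _ (once _) none-twice    ()
  far-mark⇒≢ _ twice    none-twice    ()

  -- Marked labels lie in {`once i`, `twice`}, whose two elements are at distance one.
  ¬far-mark-mark : (k l : Label p) → ¬ Far (mark i k) (mark i l)
  ¬far-mark-mark none     none     (once-once i≢i) = i≢i refl
  ¬far-mark-mark none     (once _) ()
  ¬far-mark-mark none     twice    ()
  ¬far-mark-mark (once _) none     ()
  ¬far-mark-mark (once _) (once _) ()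
  ¬far-mark-mark (once _) twice    ()
  ¬far-mark-mark twice    none     ()
  ¬far-mark-mark twice    (once _) ()
  ¬far-mark-mark twice    twice    ()

-- The points seen by a hyperedge, recorded by their old label and their side
-- of the new cut.
module Relabelling {p : ℕ} (i : Fin p) (Seen : Label p × Bool → Set) where

  Spans : (Label p × Bool → Label p × Bool → Set) → Set
  Spans R = ∃₂ λ x y → Seen x × Seen y × R x y

  OldDistinct OldFar NewDistinct NewFar CutCrossed CoreCrossed : Set
  OldDistinct = Spans λ x y → proj₁ x ≢ proj₁ y
  OldFar      = Spans λ x y → Far (proj₁ x) (proj₁ y)
  NewDistinct = Spans λ x y → relabel i x ≢ relabel i y
  NewFar      = Spans λ x y → Far (relabel i x) (relabel i y)
  CutCrossed  = Spans λ x y → proj₂ x ≡ true × proj₂ y ≡ false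
  -- The core consists of the points outside the new cut already labelled `twice`; its complement is
  -- the `K` of the overview.
  CoreCrossed = Spans λ x y → x ≢ (twice , false) × y ≡ (twice , false)

  -- This and the next four lemmas cover the ways a hyperedge can contribute to the new diameter
  -- plus the core cut. Each supplies enough events among `OldDistinct`, `OldFar` and `CutCrossed`
  -- to pay for that contribution.
  newDistinct⇒ : NewDistinct → OldDistinct ⊎ CutCrossed
  newDistinct⇒ ((k , b) , (l , c) , sx , sy , x≢y) with k ≟ˡ l
  ... | no k≢l = inj₁ (_ , _ , sx , sy , k≢l)
  newDistinct⇒ ((k , true)  , (k , true)  , sx , sy , x≢y) | yes refl = contradiction refl x≢y
  newDistinct⇒ ((k , true)  , (k , false) , sx , sy , x≢y) | yes refl = inj₂ (_ , _ , sx , sy , refl , refl)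
  newDistinct⇒ ((k , false) , (k , true)  , sx , sy , x≢y) | yes refl = inj₂ (_ , _ , sy , sx , refl , refl)
  newDistinct⇒ ((k , false) , (k , false) , sx , sy , x≢y) | yes refl = contradiction refl x≢y

  coreCrossed⇒ : CoreCrossed → OldDistinct ⊎ CutCrossed
  coreCrossed⇒ ((k , b) , _ , sx , sy , x≢ , refl) with k ≟ˡ twice
  ... | no k≢ = inj₁ (_ , _ , sx , sy , k≢)
  coreCrossed⇒ ((_ , true)  , _ , sx , sy , x≢ , refl) | yes refl = inj₂ (_ , _ , sx , sy , refl , refl)
  coreCrossed⇒ ((_ , false) , _ , sx , sy , x≢ , refl) | yes refl = contradiction refl x≢

  newFar⇒ : NewFar → OldDistinct × (OldFar ⊎ CutCrossed)
  newFar⇒ ((k , true)  , (l , true)  , sx , sy , far) =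
    (_ , _ , sx , sy , far⇒≢ far) , inj₁ (_ , _ , sx , sy , far)
  newFar⇒ ((k , true)  , (l , false) , sx , sy , far) =
    (_ , _ , sx , sy , far-mark⇒≢ i k l far) , inj₂ (_ , _ , sx , sy , refl , refl)
  newFar⇒ ((k , false) , (l , true)  , sx , sy , far) =
    (_ , _ , sy , sx , far-mark⇒≢ i l k (far-sym far)) , inj₂ (_ , _ , sy , sx , refl , refl)
  newFar⇒ ((k , false) , (l , false) , sx , sy , far) = ⊥-elim (¬far-mark-mark i k l far)

  -- A core point serves as a third witness. Both points cannot have old label `twice`, since
  -- relabelling fixes it; and a point in the cut, or one labelled `none`, pairs with the core
  -- point.
  newDistinct-core⇒ : NewDistinct → CoreCrossed → OldDistinct × (OldFar ⊎ CutCrossed)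
  newDistinct-core⇒ (x , y , sx , sy , x≢y) (_ , _ , _ , core , _ , refl) = distinct x y sx sy x≢y , far x y sx sy x≢y
    where
    relabel-twice : ∀ b → relabel i (twice , b) ≡ twice
    relabel-twice true  = refl
    relabel-twice false = refl
    distinct : ∀ x y → Seen x → Seen y → relabel i x ≢ relabel i y → OldDistinct
    distinct (k , b) (l , c) sx sy x≢y with k ≟ˡ twice | l ≟ˡ twice
    ... | no k≢    | _        = _ , _ , sx , core , k≢
    ... | yes _    | no l≢    = _ , _ , sy , core , l≢
    ... | yes refl | yes refl = contradiction (trans (relabel-twice b) (sym (relabel-twice c))) x≢y
    far : ∀ x y → Seen x → Seen y → relabel i x ≢ relabel i y → OldFar ⊎ CutCrossed
    far (_      , true)  _                sx _  _   = inj₂ (_ , _ , sx , core , refl , refl)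
    far _                (_      , true)  _  sy _   = inj₂ (_ , _ , sy , core , refl , refl)
    far (none   , false) _                sx _  _   = inj₁ (_ , _ , sx , core , none-twice)
    far _                (none   , false) _  sy _   = inj₁ (_ , _ , sy , core , none-twice)
    -- Outside the cut, `once` and `twice` both become `twice`, so the new labels would agree.
    far (once _ , false) (once _ , false) _  _  x≢y = contradiction refl x≢y
    far (once _ , false) (twice  , false) _  _  x≢y = contradiction refl x≢y
    far (twice  , false) (once _ , false) _  _  x≢y = contradiction refl x≢y
    far (twice  , false) (twice  , false) _  _  x≢y = contradiction refl x≢y

  -- Two marked labels are never far, so one point lies in the cut and the core point lies outside
  -- it. If the other point is marked, one of the two old labels is `none`, which is far from the
  -- core label.
  newFar-core⇒ : NewFar → CoreCrossed → OldFar × CutCrossed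
  newFar-core⇒ (x , y , sx , sy , far) (_ , _ , _ , core , _ , refl) = go x y sx sy far
    where
    mixed : ∀ k l → Seen (k , true) → Seen (l , false) → Far k (mark i l) → OldFar
    mixed _    none     sx sy _          = _ , _ , sy , core , none-twice
    mixed none (once _) sx sy none-twice = _ , _ , sx , core , none-twice
    mixed none twice    sx sy none-twice = _ , _ , sx , core , none-twice
    go : ∀ x y → Seen x → Seen y → Far (relabel i x) (relabel i y) → OldFar × CutCrossed
    go (k , true)  (l , true)  sx sy far = (_ , _ , sx , sy , far) , (_ , _ , sx , core , refl , refl)
    go (k , true)  (l , false) sx sy far = mixed k l sx sy far , (_ , _ , sx , core , refl , refl)
    go (k , false) (l , true)  sx sy far = mixed l k sy sx (far-sym far) , (_ , _ , sy , core , refl , refl)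
    go (k , false) (l , false) sx sy far = ⊥-elim (¬far-mark-mark i k l far)

Separates : (Label p → Label p → Set) → (Fin n → Label p) → Subset n → Set
Separates R ℓ e = ∃₂ λ x y → x ∈ e × y ∈ e × R (ℓ x) (ℓ y)

separates? : {R : Label p → Label p → Set} → (∀ k l → Dec (R k l)) →
             (ℓ : Fin n → Label p) → Decidable (Separates R ℓ)
separates? R? ℓ e = any? λ x → any? λ y → (x ∈? e) ×-dec (y ∈? e) ×-dec R? (ℓ x) (ℓ y)

distinct? : (ℓ : Fin n → Label p) → Decidable (Separates _≢_ ℓ)
distinct? = separates? λ k l → ¬? (k ≟ˡ l)

farApart? : (ℓ : Fin n → Label p) → Decidable (Separates Far ℓ)
farApart? = separates? far?

-- The diameter of the set of labels on e.
spread : (Fin n → Label p) → Subset n → ℕ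
spread ℓ e = indicator (distinct? ℓ e) + indicator (farApart? ℓ e)

-- As `N₂` implies `N₁`, the left side is between 0 and 3; the hypotheses settle each positive value
-- by exhibiting that many events on the right.
spread-bound : {N₁ N₂ C O₁ O₂ B : Set}
  (n₁? : Dec N₁) (n₂? : Dec N₂) (c? : Dec C) (o₁? : Dec O₁) (o₂? : Dec O₂) (b? : Dec B) →
  (N₂ → N₁) → (O₂ → O₁) → (N₁ → O₁ ⊎ B) → (C → O₁ ⊎ B) →
  (N₂ → O₁ × (O₂ ⊎ B)) → (N₁ → C → O₁ × (O₂ ⊎ B)) → (N₂ → C → O₂ × B) →
  (indicator n₁? + indicator n₂?) + indicator c? ≤ (indicator o₁? + indicator o₂?) + indicator b?
spread-bound {N₁} {N₂} {C} {O₁} {O₂} {B} n₁? n₂? c? o₁? o₂? b? n₂⇒n₁ o₂⇒o₁ f g f₂ fg f₂g = go n₁? n₂? c?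
  where
  one : O₁ ⊎ B → 1 ≤ (indicator o₁? + indicator o₂?) + indicator b?
  one (inj₁ o) = ≤-trans (indicator-yes o₁? o) (≤-trans (m≤m+n _ _) (m≤m+n _ _))
  one (inj₂ b) = ≤-trans (indicator-yes b? b) (m≤n+m _ _)
  two : O₁ × (O₂ ⊎ B) → 2 ≤ (indicator o₁? + indicator o₂?) + indicator b?
  two (o , r) = ≤-trans (+-mono-≤ (indicator-yes o₁? o) (indicator-either o₂? b? r))
                        (≤-reflexive (sym (+-assoc (indicator o₁?) _ _)))
  three : O₂ × B → 3 ≤ (indicator o₁? + indicator o₂?) + indicator b?
  three (o , b) = +-mono-≤ (+-mono-≤ (indicator-yes o₁? (o₂⇒o₁ o)) (indicator-yes o₂? o)) (indicator-yes b? b)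
  go : (n₁? : Dec N₁) (n₂? : Dec N₂) (c? : Dec C) →
       (indicator n₁? + indicator n₂?) + indicator c? ≤ (indicator o₁? + indicator o₂?) + indicator b?
  go (no ¬n₁) (yes n₂) _       = contradiction (n₂⇒n₁ n₂) ¬n₁
  go (no _)   (no _)   (no _)  = z≤n
  go (no _)   (no _)   (yes c) = one (g c)
  go (yes n₁) (no _)   (no _)  = one (f n₁)
  go (yes n₁) (no _)   (yes c) = two (fg n₁ c)
  go (yes _)  (yes n₂) (no _)  = two (f₂ n₂)
  go (yes _)  (yes n₂) (yes c) = three (f₂g n₂ c)

module _ {p n : ℕ} (ℓ : Fin n → Label p) (U : Subset n) where

  position : Fin n → Label p × Bool
  position v = ℓ v , lookup U v

  outsideCore? : Decidable λ v → position v ≢ (twice , false)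
  outsideCore? v = ¬? (≡-dec _≟ˡ_ _≟ᵇ_ (position v) (twice , false))

  -- The set `K` of the overview.
  coreCut : Subset n
  coreCut = comprehension outsideCore?

  -- The bound on the change of `Φ` for a single hyperedge, with both cut terms added so that no
  -- subtraction in ℕ occurs.
  spread-relabel : ∀ i e → spread (relabel i ∘ position) e + indicator (crossesCut? coreCut e)
                         ≤ spread ℓ e + indicator (crossesCut? U e)
  spread-relabel i e = spread-bound
    (distinct? _ e) (farApart? _ e) (crossesCut? coreCut e)
    (distinct? ℓ e) (farApart? ℓ e) (crossesCut? U e)
    far⇒distinct far⇒distinct
    (⊎-map old₁ cut ∘ newDistinct⇒ ∘ new _≢_)
    (⊎-map old₁ cut ∘ coreCrossed⇒ ∘ core)
    (×-map old₁ (⊎-map old₂ cut) ∘ newFar⇒ ∘ new Far)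
    (λ s c → ×-map old₁ (⊎-map old₂ cut) (newDistinct-core⇒ (new _≢_ s) (core c)))
    (λ s c → ×-map old₂ cut (newFar-core⇒ (new Far s) (core c)))
    where
    open Relabelling i (λ x → ∃ λ v → v ∈ e × position v ≡ x)
    far⇒distinct : {ℓ′ : Fin n → Label p} → Separates Far ℓ′ e → Separates _≢_ ℓ′ e
    far⇒distinct (x , y , x∈e , y∈e , far) = x , y , x∈e , y∈e , far⇒≢ far
    new : (R : Label p → Label p → Set) → Separates R (relabel i ∘ position) e →
          Spans λ x y → R (relabel i x) (relabel i y)
    new R (x , y , x∈e , y∈e , r) = _ , _ , (x , x∈e , refl) , (y , y∈e , refl) , r
    old : (R : Label p → Label p → Set) → Spans (λ x y → R (proj₁ x) (proj₁ y)) → Separates R ℓ e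
    old R (_ , _ , (x , x∈e , refl) , (y , y∈e , refl) , r) = x , y , x∈e , y∈e , r
    old₁ : OldDistinct → Separates _≢_ ℓ e
    old₁ = old _≢_
    old₂ : OldFar → Separates Far ℓ e
    old₂ = old Far
    cut : CutCrossed → CrossesCut U e
    cut (_ , _ , (x , x∈e , refl) , (y , y∈e , refl) , x-in , y-out) =
      crossesCut x∈e (lookup⇒[]= x U x-in) y∈e (lookup⇒∉ y-out)
    core : CrossesCut coreCut e → CoreCrossed
    core c with crossesCut⁻ c
    ... | x , y , (x∈e , x∈) , (y∈e , y∉) =
      _ , _ , (x , x∈e , refl) , (y , y∈e , refl) , ∈-comprehension⁻ outsideCore? x∈
      , decidable-stable (≡-dec _≟ˡ_ _≟ᵇ_ (position y) (twice , false)) (y∉ ∘ ∈-comprehension⁺ outsideCore?)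

-- Adding the cheap cuts one at a time

module Uncrossing
  (G : Hypergraph) (V₁ S : VertexSet G)
  (S-good : ∀ U → S ⊆ U → U ⊆ V₁ → d G V₁ ≤ d G U)
  {p : ℕ} (point : Fin p → Fin (order G)) (cut : Fin p → VertexSet G)
  (point∈S : ∀ i → point i ∈ S)
  (point-injective : Injective _≡_ _≡_ point)
  (point∉cut : ∀ i → point i ∉ cut i)
  (S-point⊆cut : ∀ i → S - point i ⊆ cut i)
  (cut⊆V₁ : ∀ i → cut i ⊆ V₁)
  (d-cut : ∀ i → d G (cut i) < d G V₁)
  where

  -- The head of the list is the cut added last.
  labels : List (Fin p) → Fin (order G) → Label p
  labels []       v = none
  labels (i ∷ is) v = relabel i (position (labels is) (cut i) v)

  -- The potential `Φ` of the overview.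
  weight : List (Fin p) → ℕ
  weight is = total (spread (labels is)) (edges G)

  weight-[] : weight [] ≡ 0
  weight-[] = total-zero
    (λ e → cong₂ _+_ (indicator-no (distinct? (labels []) e) λ (_ , _ , _ , _ , ≢) → ≢ refl)
                     (indicator-no (farApart? (labels []) e) λ (_ , _ , _ , _ , far) → far⇒≢ far refl))
    (edges G)

  weight-step : ∀ i is → weight (i ∷ is) + d G (coreCut (labels is) (cut i)) ≤ weight is + d G (cut i)
  weight-step i is
    rewrite length-filter≡total (crossesCut? (coreCut (labels is) (cut i))) (edges G)
          | length-filter≡total (crossesCut? (cut i)) (edges G) =
    total-+-mono (spread-relabel (labels is) (cut i) i) (edges G)

  -- For `j ≢ i`, `point i` lies in `S - point j` and hence in `cut j`, so it avoids every
  -- complement used so far.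
  labels-fresh : ∀ {i is} → All (i ≢_) is → labels is (point i) ≡ none
  labels-fresh [] = refl
  labels-fresh {i} {j ∷ js} (i≢j ∷ i∉js)
    rewrite labels-fresh i∉js
          | []=⇒lookup (S-point⊆cut j (x∈p∧x≢y⇒x∈p-y (point∈S i) (i≢j ∘ point-injective))) = refl

  -- Among the listed cuts only `cut i` misses `point i`. This makes the `once` classes nonempty.
  labels-point : ∀ {i is} → Unique is → i ∈ˡ is → labels is (point i) ≡ once i
  labels-point {i} (i∉is ∷ _) (here refl)
    rewrite labels-fresh i∉is | ∉⇒lookup (point∉cut i) = refl
  labels-point {i} {j ∷ js} (j∉js ∷ u) (there i∈js)
    rewrite labels-point u i∈js
          | []=⇒lookup (S-point⊆cut j (x∈p∧x≢y⇒x∈p-y (point∈S i)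
              (λ eq → All¬⇒¬Any j∉js (subst (_∈ˡ js) (point-injective eq) i∈js)))) = refl

  -- Every cut is contained in `V₁`, so a vertex outside `V₁` is marked at each step and two steps
  -- suffice.
  labels-outside : ∀ {v} → v ∉ V₁ → ∀ is → 2 ≤ length is → labels is v ≡ twice
  labels-outside v∉V₁ (_ ∷ []) (s≤s ())
  labels-outside v∉V₁ (i ∷ j ∷ []) _
    rewrite ∉⇒lookup (v∉V₁ ∘ cut⊆V₁ i) | ∉⇒lookup (v∉V₁ ∘ cut⊆V₁ j) = refl
  labels-outside v∉V₁ (i ∷ j ∷ k ∷ is) _
    rewrite labels-outside v∉V₁ (j ∷ k ∷ is) (s≤s (s≤s z≤n)) | ∉⇒lookup (v∉V₁ ∘ cut⊆V₁ i) = refl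

  -- Goodness of `S` applies to the core cut. It contains `S`: `point i` is still labelled `none`,
  -- and the rest of `S` lies in `cut i`. It stays inside `V₁` because two earlier cuts have
  -- labelled everything outside `V₁` `twice`.
  d-coreCut : ∀ {i j k is} → Unique (i ∷ j ∷ k ∷ is) → d G V₁ ≤ d G (coreCut (labels (j ∷ k ∷ is)) (cut i))
  d-coreCut {i} {j} {k} {is} (i∉ ∷ _) = S-good _ S⊆core core⊆V₁
    where
    ℓ = labels (j ∷ k ∷ is)
    S⊆core : S ⊆ coreCut ℓ (cut i)
    S⊆core {v} v∈S = ∈-comprehension⁺ (outsideCore? ℓ (cut i)) in-core⇒⊥
      where
      in-core⇒⊥ : position ℓ (cut i) v ≢ (twice , false)
      in-core⇒⊥ eq with v ≟ point i
      ... | yes refl = contradiction (trans (sym (labels-fresh i∉)) (cong proj₁ eq)) λ ()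
      ... | no  v≢i  = lookup⇒∉ (cong proj₂ eq) (S-point⊆cut i (x∈p∧x≢y⇒x∈p-y v∈S v≢i))
    core⊆V₁ : coreCut ℓ (cut i) ⊆ V₁
    core⊆V₁ {v} v∈ with v ∈? V₁
    ... | yes v∈V₁ = v∈V₁
    ... | no  v∉V₁ = contradiction
      (cong₂ _,_ (labels-outside v∉V₁ (j ∷ k ∷ is) (s≤s (s≤s z≤n))) (∉⇒lookup (v∉V₁ ∘ cut⊆V₁ i)))
      (∈-comprehension⁻ (outsideCore? ℓ (cut i)) v∈)

  -- The first two cuts each add less than `d G V₁`. From the third on, `d-coreCut` shows that the
  -- core cut costs at least as much as the added cut, so the weight does not grow.
  weight-bound : ∀ is → 2 ≤ length is → Unique is → weight is < d G V₁ + d G V₁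
  weight-bound (_ ∷ []) (s≤s ())
  weight-bound (i ∷ j ∷ []) _ _ = begin-strict
    weight (i ∷ j ∷ [])         ≤⟨ ≤-trans (m≤m+n _ _) (weight-step i (j ∷ [])) ⟩
    weight (j ∷ []) + d G (cut i) ≤⟨ +-monoˡ-≤ _ (≤-trans (m≤m+n _ _) (weight-step j [])) ⟩
    weight [] + d G (cut j) + d G (cut i) ≡⟨ cong (λ w → w + d G (cut j) + d G (cut i)) weight-[] ⟩
    d G (cut j) + d G (cut i)   <⟨ +-mono-< (d-cut j) (d-cut i) ⟩
    d G V₁ + d G V₁             ∎
    where open ≤-Reasoning
  weight-bound (i ∷ j ∷ k ∷ is) _ u@(_ ∷ u′) = ≤-<-trans
    (+-cancelʳ-≤ (d G (cut i)) _ _ (begin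
      weight (i ∷ j ∷ k ∷ is) + d G (cut i) ≤⟨ +-monoʳ-≤ _ (≤-trans (<⇒≤ (d-cut i)) (d-coreCut u)) ⟩
      weight (i ∷ j ∷ k ∷ is) + d G (coreCut (labels (j ∷ k ∷ is)) (cut i)) ≤⟨ weight-step i (j ∷ k ∷ is) ⟩
      weight (j ∷ k ∷ is) + d G (cut i) ∎))
    (weight-bound (j ∷ k ∷ is) (s≤s (s≤s z≤n)) u′)
    where open ≤-Reasoning

-- Merging labels into partitions

module _ {n m p : ℕ} (ℓ : Fin n → Label p) (g : Fin m → Fin p) where

  rest? : Decidable λ v → ∀ j → ℓ v ≢ once (g j)
  rest? v = all? λ j → ¬? (ℓ v ≟ˡ once (g j))

  class? : ∀ j → Decidable λ v → ℓ v ≡ once (g j)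
  class? j v = ℓ v ≟ˡ once (g j)

  -- Part `zero` absorbs `none`, `twice` and every `once` label outside the image of `g`.
  classes : Vector (Subset n) (suc m)
  classes zero    = comprehension rest?
  classes (suc j) = comprehension (class? j)

  classes-isPartition : Injective _≡_ _≡_ g → Nonempty (classes zero) → (∀ j → Nonempty (classes (suc j))) →
                        IsPartition classes
  classes-isPartition inj ne₀ ne = record
    { nonempty = λ { zero → ne₀ ; (suc j) → ne j }
    ; disjoint = λ i j i≢j (x , x∈) → let x∈i , x∈j = x∈p∩q⁻ (classes i) (classes j) x∈ in disj i j i≢j x∈i x∈j
    ; covers   = cover
    }
    where
    disj : ∀ i j → i ≢ j → ∀ {x} → x ∈ classes i → x ∈ classes j → ⊥
    disj zero    zero    i≢j _ _ = i≢j refl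
    disj zero    (suc j) _ x∈i x∈j = ∈-comprehension⁻ rest? x∈i j (∈-comprehension⁻ (class? j) x∈j)
    disj (suc i) zero    _ x∈i x∈j = ∈-comprehension⁻ rest? x∈j i (∈-comprehension⁻ (class? i) x∈i)
    disj (suc i) (suc j) i≢j x∈i x∈j = i≢j (cong suc (inj (once-injective
      (trans (sym (∈-comprehension⁻ (class? i) x∈i)) (∈-comprehension⁻ (class? j) x∈j)))))
    cover : ∀ v → ∃ λ i → v ∈ classes i
    cover v with any? (λ j → class? j v)
    ... | yes (j , eq) = suc j , ∈-comprehension⁺ (class? j) eq
    ... | no  ∄j       = zero , ∈-comprehension⁺ rest? (λ j eq → ∄j (j , eq))

  -- Of two different parts at least one is not part `zero`; its label supplies `j`.
  crossesClasses⇒ : Injective _≡_ _≡_ g → ∀ {e} → CrossesParts classes e →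
                    ∃₂ λ j x → ∃ λ y → x ∈ e × y ∈ e × ℓ x ≡ once (g j) × ℓ y ≢ once (g j)
  crossesClasses⇒ inj {e} (a , b , a≢b , ca , cb) with intersects⁻ e (classes a) ca | intersects⁻ e (classes b) cb
  crossesClasses⇒ inj (zero  , zero  , a≢b , _) | _ | _ = contradiction refl a≢b
  crossesClasses⇒ inj (zero  , suc b , _ , _) | x , x∈e , x∈a | y , y∈e , y∈b =
    b , y , x , y∈e , x∈e , ∈-comprehension⁻ (class? b) y∈b , ∈-comprehension⁻ rest? x∈a b
  crossesClasses⇒ inj (suc a , zero  , _ , _) | x , x∈e , x∈a | y , y∈e , y∈b =
    a , x , y , x∈e , y∈e , ∈-comprehension⁻ (class? a) x∈a , ∈-comprehension⁻ rest? y∈b a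
  crossesClasses⇒ inj (suc a , suc b , a≢b , _) | x , x∈e , x∈a | y , y∈e , y∈b =
    a , x , y , x∈e , y∈e , ∈-comprehension⁻ (class? a) x∈a ,
    λ eq → a≢b (cong suc (inj (once-injective (trans (sym eq) (∈-comprehension⁻ (class? b) y∈b)))))

-- A hyperedge crossing one merged partition carries two distinct labels. If it crosses both, it
-- carries a `once` label from each of two disjoint families, and these are far apart.
cost-two-merges : (G : Hypergraph) (ℓ : Fin (order G) → Label p) (g h : Fin m → Fin p) →
  Injective _≡_ _≡_ g → Injective _≡_ _≡_ h → (∀ i j → g i ≢ h j) →
  cost G (classes ℓ g) + cost G (classes ℓ h) ≤ total (spread ℓ) (edges G)
cost-two-merges G ℓ g h g-inj h-inj g≢h
  rewrite length-filter≡total (crossesParts? (classes ℓ g)) (edges G)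
        | length-filter≡total (crossesParts? (classes ℓ h)) (edges G) =
  -- The zero function pads the right side to the two-term form of `total-+-mono`.
  ≤-trans (total-+-mono {g′ = λ _ → 0} pointwise (edges G))
    (≤-reflexive (trans (cong (total (spread ℓ) (edges G) +_) (total-zero (λ _ → refl) (edges G))) (+-identityʳ _)))
  where
  distinct : ∀ {f : Fin _ → Fin _} → Injective _≡_ _≡_ f → ∀ {e} → CrossesParts (classes ℓ f) e → Separates _≢_ ℓ e
  distinct {f} f-inj c with crossesClasses⇒ ℓ f f-inj c
  ... | _ , x , y , x∈e , y∈e , eq , neq = x , y , x∈e , y∈e , λ ℓx≡ℓy → neq (trans (sym ℓx≡ℓy) eq)
  both : ∀ e → CrossesParts (classes ℓ g) e → CrossesParts (classes ℓ h) e → Separates Far ℓ e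
  both e c c′ with crossesClasses⇒ ℓ g g-inj c | crossesClasses⇒ ℓ h h-inj c′
  ... | i , x , _ , x∈e , _ , eq , _ | j , y , _ , y∈e , _ , eq′ , _ =
    x , y , x∈e , y∈e , subst₂ Far (sym eq) (sym eq′) (once-once (g≢h i j))
  pointwise : ∀ e → indicator (crossesParts? (classes ℓ g) e) + indicator (crossesParts? (classes ℓ h) e) ≤ spread ℓ e + 0
  pointwise e = ≤-trans
    (indicator-+-mono (crossesParts? (classes ℓ g) e) (crossesParts? (classes ℓ h) e) (distinct? ℓ e) (farApart? ℓ e)
      (inj₁ ∘ distinct g-inj) (inj₁ ∘ distinct h-inj) (λ c c′ → distinct g-inj c , both e c c′))
    (≤-reflexive (sym (+-identityʳ _)))

crossesCut⇒crossesParts : {P : Vector (Subset n) (suc h)} → IsPartition P →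
                          ∀ e → CrossesCut (P zero) e → CrossesParts P e
crossesCut⇒crossesParts isP e c with crossesCut⁻ c
... | x , y , (x∈e , x∈P₀) , (y∈e , y∉P₀) with IsPartition.covers isP y
...   | zero  , y∈P₀ = contradiction y∈P₀ y∉P₀
...   | suc j , y∈Pⱼ = zero , suc j , (λ ()) , intersects x∈e x∈P₀ , intersects y∈e y∈Pⱼ

-- Existence of a good set of size 2k-2

Good : (G : Hypergraph) → VertexSet G → VertexSet G → Set
Good G V₁ S = ∀ U → S ⊆ U → U ⊆ V₁ → d G V₁ ≤ d G U

module _ (G : Hypergraph) {m : ℕ} (V : Vector (VertexSet G) (suc (suc m)))
         (minimumV : IsMinimumPartition G V) where

  open IsMinimumPartition minimumV

  private
    V₁ = V zero
    -- There are `suc r` parts, so `r + r` is 2k-2.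
    r = suc m

  Cheaper : VertexSet G → VertexSet G → Set
  Cheaper S U = S ⊆ U × U ⊆ V₁ × d G U < d G V₁

  cheaper? : ∀ S → Decidable (Cheaper S)
  cheaper? S U = (S ⊆? U) ×-dec (U ⊆? V₁) ×-dec (d G U <? d G V₁)

  -- The contradiction is the chain 2 d V₁ ≤ 2 cost V ≤ `Φ` < 2 d V₁, where the middle step compares
  -- `V` with the partitions from the two halves of the `once` classes.
  ¬irredundant : ∀ S → Good G V₁ S → r + r ≤ ∣ S ∣ → ¬ (∀ u → u ∈ S → ∃ (Cheaper (S - u)))
  ¬irredundant S good 2r≤∣S∣ irredundant = <-irrefl refl (begin-strict
    d G V₁ + d G V₁               ≤⟨ length-filter-+-mono
                                       (crossesCut? V₁) (crossesCut? V₁) (crossesParts? V) (crossesParts? V)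
                                       (λ e → inj₁ ∘ crosses e) (λ e → inj₁ ∘ crosses e)
                                       (λ e c _ → crosses e c , crosses e c) (edges G) ⟩
    cost G V + cost G V           ≤⟨ +-mono-≤ (minimum _ (isPartition-of (_↑ˡ r) (↑ˡ-injective r _ _)))
                                              (minimum _ (isPartition-of (r ↑ʳ_) (↑ʳ-injective r _ _))) ⟩
    cost G (classes ℓ (_↑ˡ r)) + cost G (classes ℓ (r ↑ʳ_))
                                  ≤⟨ cost-two-merges G ℓ (_↑ˡ r) (r ↑ʳ_)
                                       (↑ˡ-injective r _ _) (↑ʳ-injective r _ _) ↑ˡ≢↑ʳ ⟩
    weight (allFin (r + r))       <⟨ weight-bound (allFin (r + r)) 2≤length (allFin⁺ (r + r)) ⟩
    d G V₁ + d G V₁               ∎)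
    where
    open ≤-Reasoning
    crosses = crossesCut⇒crossesParts isPartition
    point : Fin (r + r) → Fin (order G)
    point i = element S (inject≤ i 2r≤∣S∣)
    point∈S : ∀ i → point i ∈ S
    point∈S i = element-∈ S (inject≤ i 2r≤∣S∣)
    cheap : ∀ i → ∃ (Cheaper (S - point i))
    cheap i = irredundant (point i) (point∈S i)
    cut : Fin (r + r) → VertexSet G
    cut = proj₁ ∘ cheap
    cut-cheaper : ∀ i → Cheaper (S - point i) (cut i)
    cut-cheaper = proj₂ ∘ cheap
    point∉cut : ∀ i → point i ∉ cut i
    -- Otherwise the cut would contain all of `S`, and goodness would forbid it to be cheaper than
    -- `V₁`.
    point∉cut i point∈ = <⇒≱ (proj₂ (proj₂ (cut-cheaper i))) (good (cut i) S⊆cut (proj₁ (proj₂ (cut-cheaper i))))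
      where
      S⊆cut : S ⊆ cut i
      S⊆cut {v} v∈S with v ≟ point i
      ... | yes refl = point∈
      ... | no  v≢   = proj₁ (cut-cheaper i) (x∈p∧x≢y⇒x∈p-y v∈S v≢)
    open Uncrossing G V₁ S good point cut point∈S
      (inject≤-injective 2r≤∣S∣ 2r≤∣S∣ _ _ ∘ element-injective S) point∉cut
      (λ i → proj₁ (cut-cheaper i)) (λ i → proj₁ (proj₂ (cut-cheaper i))) (λ i → proj₂ (proj₂ (cut-cheaper i)))
    2≤length : 2 ≤ length (allFin (r + r))
    2≤length = ≤-trans (s≤s (≤-trans (s≤s z≤n) (m≤n+m (suc m) m))) (≤-reflexive (sym (length-tabulate id)))
    ℓ : Fin (order G) → Label (r + r)
    ℓ = labels (allFin (r + r))
    ↑ˡ≢↑ʳ : ∀ (i j : Fin r) → i ↑ˡ r ≢ r ↑ʳ j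
    ↑ˡ≢↑ʳ i j eq with trans (sym (splitAt-↑ˡ r i r)) (trans (cong (splitAt r) eq) (splitAt-↑ʳ r r j))
    ... | ()
    isPartition-of : (g : Fin r → Fin (r + r)) → Injective _≡_ _≡_ g → IsPartition (classes ℓ g)
    isPartition-of g g-inj = classes-isPartition ℓ g g-inj
      -- A vertex of the second part of `V` is labelled `twice`, so it falls into the rest class.
      (v , ∈-comprehension⁺ (rest? ℓ g) (λ j eq → contradiction (trans (sym (labels-outside v∉V₁ (allFin (r + r)) 2≤length)) eq) λ ()))
      (λ j → point (g j) , ∈-comprehension⁺ (class? ℓ g j)
               (labels-point (allFin⁺ (r + r)) (∈-allFin (g j))))
      where
      v = proj₁ (IsPartition.nonempty isPartition (suc zero))
      v∉V₁ : v ∉ V₁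
      v∉V₁ v∈V₁ = IsPartition.disjoint isPartition zero (suc zero) (λ ())
        (v , x∈p∩q⁺ (v∈V₁ , proj₂ (IsPartition.nonempty isPartition (suc zero))))

  -- Here `q` is the surplus over 2k-2; while it is positive, `¬irredundant` guarantees a vertex
  -- whose deletion preserves goodness.
  shrink : ∀ q S → S ⊆ V₁ → Good G V₁ S → ∣ S ∣ ≡ q + (r + r) →
           ∃ λ S′ → S′ ⊆ V₁ × ∣ S′ ∣ ≡ r + r × Good G V₁ S′
  shrink 0       S S⊆V₁ good ∣S∣≡ = S , S⊆V₁ , ∣S∣≡ , good
  shrink (suc q) S S⊆V₁ good ∣S∣≡ with any? (λ u → (u ∈? S) ×-dec ¬? (anySubset? (cheaper? (S - u))))
  ... | yes (u , u∈S , good-u) = shrink q (S - u) (λ x∈ → S⊆V₁ (p─q⊆p S _ x∈))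
    (λ U S⊆U U⊆V₁ → ≮⇒≥ λ dU< → good-u (U , S⊆U , U⊆V₁ , dU<))
    (≤-antisym (s≤s⁻¹ (≤-trans (x∈p⇒∣p-x∣<∣p∣ u∈S) (≤-reflexive ∣S∣≡)))
               (s≤s⁻¹ (≤-trans (≤-reflexive (sym ∣S∣≡)) (∣p∣≤1+∣p-x∣ S u))))
  ... | no irredundant = ⊥-elim (¬irredundant S good
    (≤-trans (m≤n+m _ (suc q)) (≤-reflexive (sym ∣S∣≡)))
    (λ u u∈S → decidable-stable (anySubset? (cheaper? (S - u))) λ ∄U → irredundant (u , u∈S , ∄U)))

  ∃-good : r + r ≤ ∣ V₁ ∣ → ∃ λ S → S ⊆ V₁ × ∣ S ∣ ≡ r + r × Good G V₁ S
  ∃-good 2r≤ = shrink (∣ V₁ ∣ ∸ (r + r)) V₁ id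
    -- For `S = V₁` the only competitor is `V₁` itself.
    (λ U V₁⊆U U⊆V₁ → ≤-reflexive (cong (d G) (⊆-antisym V₁⊆U U⊆V₁))) (sym (m∸n+n≡m 2r≤))

-- Enlarging the first part

module _ {n m : ℕ} (V : Vector (Subset n) (suc m)) (W : Subset n) where

  enlarge : Vector (Subset n) (suc m)
  enlarge zero    = W
  enlarge (suc j) = V (suc j) ─ W

  module _ (isP : IsPartition V) (V₁⊆W : V zero ⊆ W) where

    open IsPartition isP

    enlarge-isPartition : (∀ j → Nonempty (enlarge (suc j))) → IsPartition enlarge
    enlarge-isPartition ne = record
      { nonempty = λ { zero → let v , v∈ = nonempty zero in v , V₁⊆W v∈ ; (suc j) → ne j }
      ; disjoint = λ i j i≢j (x , x∈) → let x∈i , x∈j = x∈p∩q⁻ (enlarge i) (enlarge j) x∈ in disj i j i≢j x∈i x∈j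
      ; covers   = cover
      }
      where
      disj : ∀ i j → i ≢ j → ∀ {x} → x ∈ enlarge i → x ∈ enlarge j → ⊥
      disj zero    zero    i≢j _   _   = i≢j refl
      disj zero    (suc j) _   x∈i x∈j = x∈p─q⇒x∉q (V (suc j)) W x∈j x∈i
      disj (suc i) zero    _   x∈i x∈j = x∈p─q⇒x∉q (V (suc i)) W x∈i x∈j
      disj (suc i) (suc j) i≢j x∈i x∈j =
        disjoint (suc i) (suc j) i≢j (_ , x∈p∩q⁺ (p─q⊆p (V (suc i)) W x∈i , p─q⊆p (V (suc j)) W x∈j))
      cover : ∀ v → ∃ λ i → v ∈ enlarge i
      cover v with v ∈? W | covers v
      ... | yes v∈W | _            = zero , v∈W
      ... | no  v∉W | zero  , v∈V₁ = contradiction (V₁⊆W v∈V₁) v∉W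
      ... | no  v∉W | suc j , v∈Vⱼ = suc j , x∈p∧x∉q⇒x∈p─q v∈Vⱼ v∉W

    -- A hyperedge that meets `W` and also some other enlarged part crosses `W`. One that misses `W`
    -- also misses `V zero` and crosses two original parts.
    crossesEnlarged⇒ : ∀ e → CrossesParts enlarge e → CrossesParts V e × ¬ CrossesCut (V zero) e ⊎ CrossesCut W e
    crossesEnlarged⇒ e (zero  , zero  , i≢j , _) = contradiction refl i≢j
    crossesEnlarged⇒ e (zero  , suc j , _ , c , c′) with intersects⁻ e W c | intersects⁻ e (enlarge (suc j)) c′
    ... | x , x∈e , x∈W | y , y∈e , y∈ = inj₂ (crossesCut x∈e x∈W y∈e (x∈p─q⇒x∉q (V (suc j)) W y∈))
    crossesEnlarged⇒ e (suc i , zero  , _ , c , c′) with intersects⁻ e W c′ | intersects⁻ e (enlarge (suc i)) c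
    ... | x , x∈e , x∈W | y , y∈e , y∈ = inj₂ (crossesCut x∈e x∈W y∈e (x∈p─q⇒x∉q (V (suc i)) W y∈))
    crossesEnlarged⇒ e (suc i , suc j , i≢j , c , c′)
      with intersects⁻ e (enlarge (suc i)) c | intersects⁻ e (enlarge (suc j)) c′ | nonempty? (e ∩ W)
    ... | x , x∈e , x∈ | _ | yes eW with intersects⁻ e W eW
    ...   | w , w∈e , w∈W = inj₂ (crossesCut w∈e w∈W x∈e (x∈p─q⇒x∉q (V (suc i)) W x∈))
    crossesEnlarged⇒ e (suc i , suc j , i≢j , c , c′)
        | x , x∈e , x∈ | y , y∈e , y∈ | no ¬eW = inj₁
      ( (suc i , suc j , i≢j , intersects x∈e (p─q⊆p (V (suc i)) W x∈) , intersects y∈e (p─q⊆p (V (suc j)) W y∈))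
      , λ (eV₁ , _) → let v , v∈e , v∈V₁ = intersects⁻ e (V zero) eV₁ in ¬eW (intersects v∈e (V₁⊆W v∈V₁)))

-- A hyperedge counted in both left terms meets `V zero`, so `crossesEnlarged⇒` forces it to cross
-- `W`; it crosses the parts of `V` as well.
cost-enlarge : (G : Hypergraph) (V : Vector (VertexSet G) (suc m)) (W : VertexSet G) →
               IsPartition V → V zero ⊆ W →
               cost G (enlarge V W) + d G (V zero) ≤ cost G V + d G W
cost-enlarge G V W isP V₁⊆W = length-filter-+-mono
  (crossesParts? (enlarge V W)) (crossesCut? (V zero)) (crossesParts? V) (crossesCut? W)
  (λ e → ⊎-map proj₁ id ∘ crossesEnlarged⇒ V W isP V₁⊆W e)
  (λ e → inj₁ ∘ crossesCut⇒crossesParts isP e)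
  both (edges G)
  where
  both : ∀ e → CrossesParts (enlarge V W) e → CrossesCut (V zero) e → CrossesParts V e × CrossesCut W e
  both e c c′ with crossesEnlarged⇒ V W isP V₁⊆W e c
  ... | inj₁ (_ , ¬c′) = contradiction c′ ¬c′
  ... | inj₂ cW        = crossesCut⇒crossesParts isP e c′ , cW

-- From a good set to the terminal cut

module _ (G : Hypergraph) {m : ℕ} (V : Vector (VertexSet G) (suc m)) (maximalV : IsMaximalMinimumPartition G V)
         (T : VertexSet G) (T⊆∁V₁ : T ⊆ ∁ (V zero)) (T-hits : ∀ j → Nonempty (T ∩ V (suc j))) where

  open IsMaximalMinimumPartition maximalV
  open IsMinimumPartition isMinimumPartition

  private
    V₁ = V zero

  module _ {W : VertexSet G} (V₁⊆W : V₁ ⊆ W) (W⊆∁T : W ⊆ ∁ T) where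

    private
      isQ : IsPartition (enlarge V W)
      -- Each remaining part keeps a vertex of `T`, which `W` avoids.
      isQ = enlarge-isPartition V W isPartition V₁⊆W λ j →
        let t , t∈ = T-hits j ; t∈T , t∈Vⱼ = x∈p∩q⁻ T (V (suc j)) t∈ in
        t , x∈p∧x∉q⇒x∈p─q t∈Vⱼ (λ t∈W → x∈∁p⇒x∉p (W⊆∁T t∈W) t∈T)

    -- Minimality of `V` against the enlarged partition, with the cost cancelled.
    d-V₁≤ : d G V₁ ≤ d G W
    d-V₁≤ = +-cancelˡ-≤ (cost G V) _ _
      (≤-trans (+-monoˡ-≤ _ (minimum _ isQ)) (cost-enlarge G V W isPartition V₁⊆W))

    -- Otherwise the enlarged partition would be minimum with a strictly larger first part, against
    -- maximality.
    d≤⇒⊆V₁ : d G W ≤ d G V₁ → W ⊆ V₁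
    d≤⇒⊆V₁ dW≤ {x} x∈W with x ∈? V₁
    ... | yes x∈V₁ = x∈V₁
    ... | no  x∉V₁ = contradiction (enlarge V W , minimumQ , (λ {v} → V₁⊆W {v}) , x , x∈W , x∉V₁) maximal
      where
      minimumQ : IsMinimumPartition G (enlarge V W)
      minimumQ = record
        { isPartition = isQ
        ; minimum     = λ Q isPQ → ≤-trans
            (+-cancelʳ-≤ (d G V₁) _ _ (≤-trans (cost-enlarge G V W isPartition V₁⊆W) (+-monoʳ-≤ _ dW≤)))
            (minimum Q isPQ)
        }

  module _ {S : VertexSet G} (S⊆V₁ : S ⊆ V₁) (good : Good G V₁ S) where

    private
      ∪V₁⊆∁T : ∀ {U} → IsTerminalCut S T U → U ∪ V₁ ⊆ ∁ T
      ∪V₁⊆∁T {U} cutU x∈ with x∈p∪q⁻ U V₁ x∈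
      ... | inj₁ x∈U  = IsTerminalCut.U⊆∁T cutU x∈U
      ... | inj₂ x∈V₁ = x∉p⇒x∈∁p λ x∈T → x∈∁p⇒x∉p (T⊆∁V₁ x∈T) x∈V₁

      -- Submodularity, with goodness giving `d G V₁ ≤ d G (U ∩ V₁)`.
      d-∪≤ : ∀ {U} → IsTerminalCut S T U → d G (U ∪ V₁) ≤ d G U
      d-∪≤ {U} cutU = +-cancelʳ-≤ (d G V₁) _ _ (≤-trans
        (+-monoʳ-≤ (d G (U ∪ V₁)) (good (U ∩ V₁)
          (λ x∈S → x∈p∩q⁺ (IsTerminalCut.S⊆U cutU x∈S , S⊆V₁ x∈S)) (p∩q⊆q U V₁)))
        (d-submodular G U V₁))

      -- Any terminal cut may first be replaced by its union with `V₁`, where `d-V₁≤` applies. The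
      -- index `j` names another part, so that the sink side is nonempty.
      minimumV₁ : Fin m → IsMinimumTerminalCut G S T V₁
      minimumV₁ j = record
        { isTerminalCut = record
          { source-nonempty = IsPartition.nonempty isPartition zero
          ; sink-nonempty   = let t , t∈ = T-hits j in t , T⊆∁V₁ (proj₁ (x∈p∩q⁻ T (V (suc j)) t∈))
          ; S⊆U             = S⊆V₁
          ; U⊆∁T            = λ x∈V₁ → x∉p⇒x∈∁p λ x∈T → x∈∁p⇒x∉p (T⊆∁V₁ x∈T) x∈V₁
          }
        ; minimum = λ U cutU → ≤-trans (d-V₁≤ (q⊆p∪q U V₁) (∪V₁⊆∁T cutU)) (d-∪≤ cutU)
        }

      minimum⇒⊆V₁ : Fin m → ∀ {U} → IsMinimumTerminalCut G S T U → U ⊆ V₁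
      minimum⇒⊆V₁ j {U} minU x∈U =
        d≤⇒⊆V₁ (q⊆p∪q U V₁) (∪V₁⊆∁T cutU)
          (≤-trans (d-∪≤ cutU) (IsMinimumTerminalCut.minimum minU V₁ (IsMinimumTerminalCut.isTerminalCut (minimumV₁ j))))
          (p⊆p∪q V₁ x∈U)
        where cutU = IsMinimumTerminalCut.isTerminalCut minU

    V₁-isSourceMaximal : Fin m → IsSourceMaximalMinimumTerminalCut G S T V₁
    V₁-isSourceMaximal j = record
      { isInclusionMaximal = record
        { isMinimumTerminalCut = minimumV₁ j
        ; maximal = λ (U , minU , _ , x , x∈U , x∉V₁) → x∉V₁ (minimum⇒⊆V₁ j minU x∈U)
        }
      ; unique = λ U maxU → let open IsInclusionMaximalMinimumTerminalCut maxU renaming (maximal to maximalU)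
                                U⊆V₁ = minimum⇒⊆V₁ j isMinimumTerminalCut in
          -- A vertex of `V₁` missing from `U` would make `V₁` a strictly larger minimum cut.
          ⊆-antisym U⊆V₁ λ {x} x∈V₁ →
            decidable-stable (x ∈? U) λ x∉U → maximalU (V₁ , minimumV₁ j , (λ {v} → U⊆V₁ {v}) , x , x∈V₁ , x∉U)
      }

2*[1+m]∸2≡m+m : ∀ m → 2 * suc m ∸ 2 ≡ m + m
2*[1+m]∸2≡m+m m rewrite +-identityʳ m | +-suc m m = refl

theorem1p2 : (G : Hypergraph) (m : ℕ) → let k = suc m in
    2 ≤ k →
    (V : Vector (VertexSet G) k) →
    IsMaximalMinimumPartition G V →
    2 * k ∸ 2 ≤ ∣ V zero ∣ →
    (T : VertexSet G) →
    T ⊆ ∁ (V zero) →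
    (∀ (j : Fin m) → Nonempty (T ∩ V (suc j))) →
    ∃ λ (S : VertexSet G) →
    S ⊆ V zero × ∣ S ∣ ≡ 2 * k ∸ 2 × IsSourceMaximalMinimumTerminalCut G S T (V zero)
theorem1p2 G (suc m) 2≤k V maximalV 2k-2≤∣V₁∣ T T⊆∁V₁ T-hits =
  let S , S⊆V₁ , ∣S∣≡ , good = ∃-good G V (IsMaximalMinimumPartition.isMinimumPartition maximalV)
                                 (subst (_≤ ∣ V zero ∣) (2*[1+m]∸2≡m+m (suc m)) 2k-2≤∣V₁∣)
  in S , S⊆V₁ , trans ∣S∣≡ (sym (2*[1+m]∸2≡m+m (suc m)))
     , V₁-isSourceMaximal G V maximalV T T⊆∁V₁ T-hits S⊆V₁ good zero
theorem1p2 G 0 (s≤s ()) _ _ _ _ _ _
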